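{- For any fixed positive integer $s$, $$\lim_{t\to\infty}\chi_f(W(s,t))=\infty.$$
   Context: Graphs are finite, simple and undirected. For positive integers $s,t$ the graph $W(s,t)$ has vertex set consisting of all sequences $(x_1,\dots,x_t)$ with $x_i\in\{0,1,\dots,s\}$ for all $i$, such that there is exactly one index $i$ with $x_i=0$ and at least one index $j$ with $x_j=1$. Two vertices $(x_1,\dots,x_t)$ and $(y_1,\dots,y_t)$ are adjacent if and only if for every $i$ either $|x_i-y_i|=1$ or $x_i=y_i=s$. For a graph $G$ and a positive integer $k$, the $k$-fold chromatic number $\chi_k(G)$ is the minimum $n$ such that one can assign to each vertex of $G$ a set of exactly $k$ distinct colors from $\{1,\dots,n\}$ in such a way that adjacent vertices receive disjoint sets. The fractional chromatic number of $G$ is $\chi_f(G)=\inf_{k\ge 1}\frac{\chi_k(G)}{k}$. -}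

module Defs where

open import Data.Empty using (⊥-elim-irr)
open import Data.Fin.Base using (Fin; zero; suc; toℕ)
open import Data.Fin.Properties using (any?; all?) renaming (_≟_ to _≟ᶠ_)
open import Data.Fin.Subset
  using (Subset; inside; outside; ∣_∣; _∩_; Empty)
  renaming (⊤ to full; ⊥ to none; _∈_ to _∈ˢ_)
open import Data.Fin.Subset.Properties
  using (anySubset?; nonempty?; ∣⊤∣≡n; ∣⊥∣≡0; ∉⊥; x∈p∩q⁻)
open import Data.Integer.Base using (+_)
open import Data.Irrelevant using ([_])
open import Data.List.Base using (List; []; _∷_; length; allFin; cartesianProductWith)
  renaming (lookup to lookupᴸ)
open import Data.List.Membership.Propositional using (_∈_)
open import Data.List.Membership.Propositional.Properties
  using (∈-cartesianProductWith⁺; ∈-allFin)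
open import Data.List.Relation.Unary.Any using (here; there; index)
open import Data.List.Relation.Unary.Any.Properties using (lookup-index)
open import Data.Nat.Base using (ℕ; zero; suc; _+_; _*_; _≤_; _<_; ∣_-_∣)
open import Data.Nat.Induction using (<-wellFounded)
open import Data.Nat.Properties
  using (anyUpTo?; ≮⇒≥; ∣n-n∣≡0; ∣-∣-comm; 0≢1+n; +-identityʳ) renaming (_≟_ to _≟ℕ_)
open import Data.Product using (∃; ∃!; _×_; _,_; proj₁; proj₂)
open import Data.Rational.Base using (ℚ; _/_) renaming (_≤_ to _≤ℚ_)
open import Data.Refinement using (Refinement; value) renaming (_,_ to _,ʳ_)
open import Data.Sum.Base using (_⊎_; inj₁; inj₂)
open import Data.Vec.Base using (Vec; []; _∷_; lookup; tabulate; _++_; here; there)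
open import Data.Vec.Properties using (lookup∘tabulate)
open import Function.Base using (_∘_)
open import Induction.WellFounded using (Acc; acc)
open import Level using (0ℓ)
open import Relation.Binary.Core using (Rel)
open import Relation.Binary.Definitions using (Symmetric; Irreflexive)
  renaming (Decidable to Decidable₂)
open import Relation.Binary.PropositionalEquality
  using (_≡_; refl; sym; trans; cong; subst₂)
open import Relation.Nullary using (¬_; Dec; yes; no; contradiction)
open import Relation.Nullary.Decidable using (map′; ¬?; _×-dec_; _⊎-dec_; _→-dec_)
open import Relation.Unary using (Pred; Decidable; ⋂)

------------------------------------------------------------------------
-- Least natural numbers

IsMinimum : Pred ℕ 0ℓ → Pred ℕ 0ℓ
IsMinimum P n = P n × (∀ m → P m → n ≤ m)

minimum : {P : Pred ℕ 0ℓ} → Decidable P → ∃ P → ∃ (IsMinimum P)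
minimum {P} P? (n , Pn) = go n Pn (<-wellFounded n)
  where
  go : ∀ n → P n → Acc _<_ n → ∃ (IsMinimum P)
  go n Pn (acc rs) with anyUpTo? P? n
  ... | yes (m , m<n , Pm) = go m Pm (rs m<n)
  ... | no ∄m              = n , Pn , λ m Pm → ≮⇒≥ λ m<n → ∄m (m , m<n , Pm)

------------------------------------------------------------------------
-- Finite simple graphs

record Graph : Set₁ where
  field
    Vertex      : Set
    Adj         : Rel Vertex 0ℓ
    Adj?        : Decidable₂ Adj
    symmetric   : Symmetric Adj
    irreflexive : Irreflexive _≡_ Adj
    -- Repetitions are allowed in the list.
    vertices    : List Vertex
    complete    : ∀ v → v ∈ vertices

------------------------------------------------------------------------
-- k-fold colorings

record Coloring (G : Graph) (k n : ℕ) : Set where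
  open Graph G
  field
    color    : Vertex → Subset n
    size     : ∀ v → ∣ color v ∣ ≡ k
    disjoint : ∀ u v → Adj u v → Empty (color u ∩ color v)

private

  anyVec? : ∀ {A : Set} → (∀ {P : Pred A 0ℓ} → Decidable P → Dec (∃ P)) →
            ∀ N {P : Pred (Vec A N) 0ℓ} → Decidable P → Dec (∃ P)
  anyVec? any zero    P? = map′ ([] ,_) (λ { ([] , p) → p }) (P? [])
  anyVec? any (suc N) P? =
    map′ (λ { (x , xs , p) → x ∷ xs , p }) (λ { (x ∷ xs , p) → x , xs , p })
         (any λ x → anyVec? any N (P? ∘ (x ∷_)))

  -- The i-th of N consecutive blocks of k colors.
  block : ∀ {N} k → Fin N → Subset (N * k)
  block {suc N} k zero    = full {k} ++ none
  block {suc N} k (suc i) = none {k} ++ block k i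

  ∣++∣ : ∀ {m n} (p : Subset m) (q : Subset n) → ∣ p ++ q ∣ ≡ ∣ p ∣ + ∣ q ∣
  ∣++∣ []            q = refl
  ∣++∣ (inside  ∷ p) q = cong suc (∣++∣ p q)
  ∣++∣ (outside ∷ p) q = ∣++∣ p q

  ∣block∣ : ∀ {N} k (i : Fin N) → ∣ block k i ∣ ≡ k
  ∣block∣ {suc N} k zero
    rewrite ∣++∣ (full {k}) (none {N * k}) | ∣⊤∣≡n k | ∣⊥∣≡0 (N * k) = +-identityʳ k
  ∣block∣ {suc N} k (suc i)
    rewrite ∣++∣ (none {k}) (block k i) | ∣⊥∣≡0 k = ∣block∣ k i

  ++-disjoint : ∀ {m n} (p p′ : Subset m) (q q′ : Subset n) →
                Empty (p ∩ p′) → Empty (q ∩ q′) → Empty ((p ++ q) ∩ (p′ ++ q′))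
  ++-disjoint []      []        q q′ ep eq          = eq
  ++-disjoint (x ∷ p) (x′ ∷ p′) q q′ ep eq (zero , x∈) =
    ep (zero , head x∈)
    where
    head : ∀ {n n′ b} {r : Subset n} {r′ : Subset n′} →
           zero ∈ˢ (b ∷ r) → zero ∈ˢ (b ∷ r′)
    head here = here
  ++-disjoint (x ∷ p) (x′ ∷ p′) q q′ ep eq (suc i , there i∈) =
    ++-disjoint p p′ q q′ (λ { (j , j∈) → ep (suc j , there j∈) }) eq (i , i∈)

  none-disjointˡ : ∀ {n} (p : Subset n) → Empty (none ∩ p)
  none-disjointˡ p (i , i∈) = ∉⊥ (proj₁ (x∈p∩q⁻ none p i∈))

  none-disjointʳ : ∀ {n} (p : Subset n) → Empty (p ∩ none)
  none-disjointʳ p (i , i∈) = ∉⊥ (proj₂ (x∈p∩q⁻ p none i∈))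

  block-disjoint : ∀ {N} k (i j : Fin N) → ¬ i ≡ j → Empty (block k i ∩ block k j)
  block-disjoint k zero    zero    i≢j = contradiction refl i≢j
  block-disjoint {suc N} k zero (suc j) _ =
    ++-disjoint (full {k}) none none (block k j) (none-disjointʳ full) (none-disjointˡ _)
  block-disjoint {suc N} k (suc i) zero _ =
    ++-disjoint (none {k}) full (block k i) none (none-disjointˡ full) (none-disjointʳ _)
  block-disjoint {suc N} k (suc i) (suc j) i≢j =
    ++-disjoint (none {k}) none (block k i) (block k j) (none-disjointˡ none)
      (block-disjoint k i j (i≢j ∘ cong suc))

module _ (G : Graph) where
  open Graph G

  private
    order : ℕ
    order = length vertices

    vertexAt : Fin order → Vertex
    vertexAt = lookupᴸ vertices

    position : Vertex → Fin order
    position v = index (complete v)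

    vertexAt-position : ∀ v → vertexAt (position v) ≡ v
    vertexAt-position v = sym (lookup-index (complete v))

    ProperAt : ∀ k {n} → (Fin order → Subset n) → Set
    ProperAt k c = (∀ i → ∣ c i ∣ ≡ k) ×
                   (∀ i j → Adj (vertexAt i) (vertexAt j) → Empty (c i ∩ c j))

    Code : ℕ → ℕ → Set
    Code k n = ∃ λ (cs : Vec (Subset n) order) → ProperAt k (lookup cs)

    code? : ∀ k n → Dec (Code k n)
    code? k n = anyVec? anySubset? order λ cs →
      all? (λ i → ∣ lookup cs i ∣ ≟ℕ k) ×-dec
      all? (λ i → all? λ j → Adj? (vertexAt i) (vertexAt j) →-dec
                             ¬? (nonempty? (lookup cs i ∩ lookup cs j)))

    decode : ∀ {k n} → Code k n → Coloring G k n
    decode (cs , size , disj) = record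
      { color    = lookup cs ∘ position
      ; size     = size ∘ position
      ; disjoint = λ u v uv → disj (position u) (position v)
          (subst₂ Adj (sym (vertexAt-position u)) (sym (vertexAt-position v)) uv)
      }

    encode : ∀ {k n} → Coloring G k n → Code k n
    encode {k} {n} c = tabulate f ,
        (λ i → trans (cong ∣_∣ (eq i)) (size (vertexAt i))) ,
        (λ i j ij → subst₂ (λ p q → Empty (p ∩ q)) (sym (eq i)) (sym (eq j))
                      (disjoint (vertexAt i) (vertexAt j) ij))
      where
      open Coloring c
      f : Fin order → Subset n
      f = color ∘ vertexAt
      eq : ∀ i → lookup (tabulate f) i ≡ f i
      eq = lookup∘tabulate f

  coloring? : ∀ k n → Dec (Coloring G k n)
  coloring? k n = map′ decode encode (code? k n)

  coloring-exists : ∀ k → ∃ (Coloring G k)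
  coloring-exists k = order * k , record
    { color    = block k ∘ position
    ; size     = ∣block∣ k ∘ position
    ; disjoint = λ u v uv → block-disjoint k (position u) (position v)
        λ eq → irreflexive
          (trans (sym (vertexAt-position u))
                 (trans (cong vertexAt eq) (vertexAt-position v)))
          uv
    }

  χ-minimum : ∀ k → ∃ (IsMinimum (Coloring G k))
  χ-minimum k = minimum (coloring? k) (coloring-exists k)

  χ : ℕ → ℕ
  χ k = proj₁ (χ-minimum k)

------------------------------------------------------------------------
-- Real numbers as lower cuts

-- The extended real number α is represented by { q ∈ ℚ ∣ q ≤ α }, so the
-- infimum of a family is the intersection of its cuts, and q ≤ α is the
-- membership of q in α.

Cut : Set₁
Cut = Pred ℚ 0ℓ

↓_ : ℚ → Cut
(↓ r) q = q ≤ℚ r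

DivergesTo+∞ : (ℕ → Cut) → Set
DivergesTo+∞ α = ∀ (M : ℚ) → ∃ λ T → ∀ t → T ≤ t → α t M

-- The index k stands for (suc k)-fold colorings.
χf : Graph → Cut
χf G = ⋂ ℕ λ k → ↓ (+ χ G (suc k) / suc k)

------------------------------------------------------------------------
-- The graphs W(s,t)

Sequence : ℕ → ℕ → Set
Sequence s t = Vec (Fin (suc s)) t

IsVertex : ∀ {s t} → Pred (Sequence s t) 0ℓ
IsVertex x = ∃! _≡_ (λ i → toℕ (lookup x i) ≡ 0) × ∃ (λ j → toℕ (lookup x j) ≡ 1)

AdjSeq : ∀ {s t} → Rel (Sequence s t) 0ℓ
AdjSeq {s} x y = ∀ i →
  ∣ toℕ (lookup x i) - toℕ (lookup y i) ∣ ≡ 1 ⊎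
  (toℕ (lookup x i) ≡ s × toℕ (lookup y i) ≡ s)

isVertex? : ∀ {s t} → Decidable (IsVertex {s} {t})
isVertex? x =
  any? (λ i → (toℕ (lookup x i) ≟ℕ 0) ×-dec
    map′ (λ f {j} → f j) (λ f j → f {j})
         (all? λ j → (toℕ (lookup x j) ≟ℕ 0) →-dec (i ≟ᶠ j)))
  ×-dec any? (λ j → toℕ (lookup x j) ≟ℕ 1)

adjSeq? : ∀ {s t} → Decidable₂ (AdjSeq {s} {t})
adjSeq? {s} x y = all? λ i →
  (∣ toℕ (lookup x i) - toℕ (lookup y i) ∣ ≟ℕ 1) ⊎-dec
  ((toℕ (lookup x i) ≟ℕ s) ×-dec (toℕ (lookup y i) ≟ℕ s))

private

  adjSeq-sym : ∀ {s t} → Symmetric (AdjSeq {s} {t})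
  adjSeq-sym {x = x} {y} xy i with xy i
  ... | inj₁ d       = inj₁ (trans (∣-∣-comm (toℕ (lookup y i)) _) d)
  ... | inj₂ (p , q) = inj₂ (q , p)

  loopless : ∀ {s t} (x : Sequence s t) → IsVertex x → ¬ AdjSeq x x
  loopless {s} x ((i , xi≡0 , _) , (j , xj≡1)) xx =
    0≢1+n (trans (sym xi≡0) (trans (all≡s i) (trans (sym (all≡s j)) xj≡1)))
    where
    all≡s : ∀ i → toℕ (lookup x i) ≡ s
    all≡s i with xx i
    ... | inj₁ d       = contradiction (trans (sym (∣n-n∣≡0 (toℕ (lookup x i)))) d) 0≢1+n
    ... | inj₂ (p , _) = p

  sequences : ∀ s t → List (Sequence s t)
  sequences s zero    = [] ∷ []
  sequences s (suc t) = cartesianProductWith _∷_ (allFin (suc s)) (sequences s t)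

  sequences-complete : ∀ {s t} (x : Sequence s t) → x ∈ sequences s t
  sequences-complete []      = here refl
  sequences-complete (a ∷ x) =
    ∈-cartesianProductWith⁺ _∷_ (∈-allFin a) (sequences-complete x)

  module _ {A : Set} {P : Pred A 0ℓ} (P? : Decidable P) where

    refineList : List A → List (Refinement A P)
    refineList []       = []
    refineList (x ∷ xs) with P? x
    ... | yes p = (x ,ʳ [ p ]) ∷ refineList xs
    ... | no  _ = refineList xs

    ∈-refineList : ∀ {xs} (r : Refinement A P) → value r ∈ xs → r ∈ refineList xs
    ∈-refineList {x ∷ xs} (_ ,ʳ [ p ]) (here refl) with P? x
    ... | yes _ = here refl
    ... | no ¬p = ⊥-elim-irr (¬p p)
    ∈-refineList {x ∷ xs} r (there r∈xs) with P? x
    ... | yes _ = there (∈-refineList r r∈xs)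
    ... | no  _ = ∈-refineList r r∈xs

W : (s t : ℕ) → Graph
W s t = record
  { Vertex      = Refinement (Sequence s t) IsVertex
  ; Adj         = λ u v → AdjSeq (value u) (value v)
  ; Adj?        = λ u v → adjSeq? (value u) (value v)
  ; symmetric   = λ {u} {v} → adjSeq-sym {x = value u} {value v}
  ; irreflexive = λ { {x ,ʳ [ p ]} refl xx → ⊥-elim-irr (loopless x p xx) }
  ; vertices    = refineList isVertex? (sequences s t)
  ; complete    = λ v → ∈-refineList isVertex? v (sequences-complete (value v))
  }

{-# OPTIONS --safe #-}
-- Suppose that W(s,t) has a fractional coloring with at most U colors per unit.
-- Then any weighting of W(s,t) with total weight f and independent sets of weight
-- at most 1 extends to a weighting of W(s,t+1) with total weight f + 1/B, where B
-- depends on s and U only: W(s,t+1) contains a homomorphic image of a long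
-- generalized Mycielskian of W(s,t), whose levels are weighted geometrically with
-- ratio U.  As the total weight never exceeds U, the bound U fails for t > U B + 1.
module Submission where

open import Defs
open import Data.Bool.Base using (Bool; true; false; T; _∧_; _∨_; not; if_then_else_)
open import Data.Empty using (⊥)
open import Data.Fin.Base using (Fin; zero; suc; toℕ; fromℕ<)
open import Data.Fin.Properties using (toℕ-fromℕ<; toℕ≤pred[n])
open import Data.Fin.Subset using (Subset; inside; outside; ∣_∣)
open import Data.Fin.Subset.Properties using (x∈p∩q⁺)
open import Data.Integer.Base as ℤ using (-[1+_]; +≤+)
import Data.Integer.Properties as ℤ
open import Data.Irrelevant using ([_])
open import Data.Nat.Base
  using (ℕ; zero; suc; pred; NonZero; _+_; _*_; _∸_; _^_; _⊓_; _⊔_; _≤_; _<_; z≤n; s≤s;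
         ∣_-_∣; parity; >-nonZero⁻¹)
open import Data.Nat.Properties
open import Data.Nat.Tactic.RingSolver using (solve-∀)
open import Data.Parity.Base using (Parity; 0ℙ; 1ℙ)
open import Data.Parity.Properties using (p+p≡0ℙ; +-homo-+; suc-homo-⁻¹)
open import Data.Product using (_×_; _,_; proj₁; proj₂)
open import Data.Rational.Base using (ℚ; mkℚ; _/_) renaming (_≤_ to _≤ℚ_)
open import Data.Rational.Properties using (toℚᵘ-cancel-≤; toℚᵘ-fromℚᵘ)
open import Data.Rational.Unnormalised.Base as ℚᵘ using (mkℚᵘ; *≤*)
import Data.Rational.Unnormalised.Properties as ℚᵘ
open import Data.Refinement using () renaming (_,_ to _,ʳ_)
open import Data.Sum.Base using (_⊎_; inj₁; inj₂)
open import Data.Unit.Base using (tt)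
open import Data.Vec.Base using ([]; _∷_; tail; lookup; map; replicate)
open import Data.Vec.Properties using (lookup-map; lookup⇒[]=)
open import Function.Base using (_∘_)
open import Relation.Binary.Definitions using (tri<; tri≈; tri>)
open import Relation.Binary.PropositionalEquality
  using (_≡_; _≢_; refl; sym; trans; cong; cong₂; subst)
open import Relation.Nullary using (yes; no; contradiction)

-- Measures and independent sets

-- A weighting enters only through its integrals, so pushing it along a map needs no sums over
-- fibres. Weights are natural numbers; an explicit bound S on independent sets replaces
-- normalization to 1.
record Measure (A : Set) : Set where
  field
    ∫        : (A → ℕ) → ℕ
    mono     : ∀ {f g} → (∀ x → f x ≤ g x) → ∫ f ≤ ∫ g
    additive : ∀ f g → ∫ (λ x → f x + g x) ≡ ∫ f + ∫ g

  ∫-0 : ∫ (λ _ → 0) ≡ 0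
  ∫-0 = sym (+-cancelˡ-≡ (∫ λ _ → 0) 0 _
          (trans (+-identityʳ _) (additive (λ _ → 0) (λ _ → 0))))

  ∫-* : ∀ c f → ∫ (λ x → c * f x) ≡ c * ∫ f
  ∫-* zero    f = ∫-0
  ∫-* (suc c) f = trans (additive f (λ x → c * f x)) (cong (∫ f +_) (∫-* c f))

open Measure using (∫)

module _ {A : Set} where

  null : Measure A
  null = record { ∫ = λ _ → 0 ; mono = λ _ → z≤n ; additive = λ _ _ → refl }

  dirac : A → Measure A
  dirac a = record { ∫ = λ f → f a ; mono = λ f≤g → f≤g a ; additive = λ _ _ → refl }

  _·_ : ℕ → Measure A → Measure A
  c · μ = record
    { ∫        = λ f → c * ∫ μ f
    ; mono     = λ f≤g → *-monoʳ-≤ c (Measure.mono μ f≤g)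
    ; additive = λ f g → trans (cong (c *_) (Measure.additive μ f g)) (*-distribˡ-+ c _ _)
    }

  _⊕_ : Measure A → Measure A → Measure A
  μ ⊕ ν = record
    { ∫        = λ f → ∫ μ f + ∫ ν f
    ; mono     = λ f≤g → +-mono-≤ (Measure.mono μ f≤g) (Measure.mono ν f≤g)
    ; additive = λ f g → trans (cong₂ _+_ (Measure.additive μ f g) (Measure.additive ν f g))
                               (interchange (∫ μ f) (∫ μ g) (∫ ν f) (∫ ν g))
    }
    where
    interchange : ∀ a b c d → (a + b) + (c + d) ≡ (a + c) + (b + d)
    interchange = solve-∀

  pushforward : {B : Set} → (B → A) → Measure B → Measure A
  pushforward φ μ = record
    { ∫        = λ f → ∫ μ (f ∘ φ)
    ; mono     = λ f≤g → Measure.mono μ (f≤g ∘ φ)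
    ; additive = λ f g → Measure.additive μ (f ∘ φ) (g ∘ φ)
    }

⟦_⟧ : Bool → ℕ
⟦ b ⟧ = if b then 1 else 0

⟦⟧-split : ∀ a c → ⟦ a ⟧ ≤ ⟦ c ∧ a ⟧ + ⟦ a ∧ not c ⟧
⟦⟧-split false c     = z≤n
⟦⟧-split true  false = ≤-refl
⟦⟧-split true  true  = ≤-refl

⟦⟧-∨ : ∀ a c b → ⟦ (a ∧ not c) ∧ b ⟧ + ⟦ c ⟧ ≤ ⟦ ((a ∧ not c) ∧ b) ∨ c ⟧
⟦⟧-∨ false c     b     = ≤-refl
⟦⟧-∨ true  false false = ≤-refl
⟦⟧-∨ true  false true  = ≤-refl
⟦⟧-∨ true  true  b     = ≤-refl

T-∧⁻ : ∀ {a b} → T (a ∧ b) → T a × T b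
T-∧⁻ {true} {true} _ = tt , tt

T-∨⁻ : ∀ {a b} → T (a ∨ b) → T a ⊎ T b
T-∨⁻ {true}          _ = inj₁ tt
T-∨⁻ {false} {true}  _ = inj₂ tt

T⇒≡ : ∀ {b} → T b → b ≡ true
T⇒≡ {true} _ = refl

-- Double counting of the pairs of a vertex of `B` and one of its colors, by induction on the number
-- of colors.
∫-colors : ∀ {A : Set} (μ : Measure A) n (B : A → Bool) (p : A → Subset n) {δ} →
           (∀ c → ∫ μ (λ v → ⟦ B v ∧ lookup (p v) c ⟧) ≤ δ) →
           ∫ μ (λ v → ⟦ B v ⟧ * ∣ p v ∣) ≤ n * δ
∫-colors μ zero B p _ = ≤-trans (Measure.mono μ (λ v → step (B v) (p v)))
                                (≤-reflexive (Measure.∫-0 μ))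
  where
  step : ∀ b (q : Subset 0) → ⟦ b ⟧ * ∣ q ∣ ≤ 0
  step b [] = ≤-reflexive (*-zeroʳ ⟦ b ⟧)
∫-colors μ (suc n) B p {δ} bound = begin
  ∫ μ (λ v → ⟦ B v ⟧ * ∣ p v ∣)
    ≤⟨ Measure.mono μ (λ v → step (B v) (p v)) ⟩
  ∫ μ (λ v → ⟦ B v ∧ lookup (p v) zero ⟧ + ⟦ B v ⟧ * ∣ tail (p v) ∣)
    ≡⟨ Measure.additive μ _ _ ⟩
  ∫ μ (λ v → ⟦ B v ∧ lookup (p v) zero ⟧) + ∫ μ (λ v → ⟦ B v ⟧ * ∣ tail (p v) ∣)
    ≤⟨ +-mono-≤ (bound zero) (∫-colors μ n B (tail ∘ p) λ c →
         ≤-trans (Measure.mono μ (λ v → ≤-reflexive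
           (cong (λ b → ⟦ B v ∧ b ⟧) (lookup-tail (p v) c)))) (bound (suc c))) ⟩
  δ + n * δ ∎
  where
  open ≤-Reasoning
  step : ∀ {n} b (q : Subset (suc n)) →
         ⟦ b ⟧ * ∣ q ∣ ≤ ⟦ b ∧ lookup q zero ⟧ + ⟦ b ⟧ * ∣ tail q ∣
  step false q             = z≤n
  step true  (outside ∷ q) = ≤-refl
  step true  (inside  ∷ q) = ≤-refl

  lookup-tail : ∀ {n} (q : Subset (suc n)) c → lookup (tail q) c ≡ lookup q (suc c)
  lookup-tail (x ∷ q) c = refl

Separated : (G : Graph) (I J : Graph.Vertex G → Bool) → Set
Separated G I J = ∀ {u v} → Graph.Adj G u v → T (I u) → T (J v) → ⊥

Independent : (G : Graph) → (Graph.Vertex G → Bool) → Set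
Independent G I = Separated G I I

_BoundedBy_ : ∀ {G} → Measure (Graph.Vertex G) → ℕ → Set
_BoundedBy_ {G} μ S = ∀ I → Independent G I → ∫ μ (⟦_⟧ ∘ I) ≤ S

-- Averaging over color classes

module FractionalColoring {G : Graph} {k n U : ℕ} (C : Coloring G (suc k) n)
                          (n≤ : n ≤ U * suc k) (μ : Measure (Graph.Vertex G)) where
  open Graph G
  open Coloring C

  class : Fin n → Vertex → Bool
  class c v = lookup (color v) c

  class-independent : ∀ c → Independent G (class c)
  class-independent c {u} {v} uv cu cv = disjoint u v uv
    (c , x∈p∩q⁺ (lookup⇒[]= c (color u) (T⇒≡ cu) , lookup⇒[]= c (color v) (T⇒≡ cv)))

  -- Every vertex lies in `suc k` of the at most `U * suc k` color classes.
  ∫-≤ : ∀ (B : Vertex → Bool) {δ} →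
        (∀ c → ∫ μ (λ v → ⟦ B v ∧ class c v ⟧) ≤ δ) → ∫ μ (⟦_⟧ ∘ B) ≤ U * δ
  ∫-≤ B {δ} bound = *-cancelˡ-≤ (suc k) (begin
    suc k * ∫ μ (⟦_⟧ ∘ B)                 ≡⟨ Measure.∫-* μ (suc k) _ ⟨
    ∫ μ (λ v → suc k * ⟦ B v ⟧)           ≤⟨ Measure.mono μ (λ v → ≤-reflexive
      (trans (*-comm (suc k) ⟦ B v ⟧) (cong (⟦ B v ⟧ *_) (sym (size v))))) ⟩
    ∫ μ (λ v → ⟦ B v ⟧ * ∣ color v ∣)     ≤⟨ ∫-colors μ n B color bound ⟩
    n * δ                                 ≤⟨ *-monoˡ-≤ δ n≤ ⟩
    U * suc k * δ                         ≡⟨ rearrange U (suc k) δ ⟩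
    suc k * (U * δ)                       ∎)
    where
    open ≤-Reasoning
    rearrange : ∀ a b c → a * b * c ≡ b * (a * c)
    rearrange = solve-∀

  module _ {S : ℕ} (bounded : _BoundedBy_ {G} μ S) where

    total≤ : ∫ μ (λ _ → 1) ≤ U * S
    total≤ = ∫-≤ (λ _ → true) (λ c → bounded (class c) (class-independent c))

    -- The union of I and the part of a color class in A outside I is independent.
    exchange : ∀ {I A : Vertex → Bool} → Independent G I → Separated G I A →
               ∫ μ (⟦_⟧ ∘ A) + U * ∫ μ (⟦_⟧ ∘ I) ≤ ∫ μ (λ v → ⟦ I v ∧ A v ⟧) + U * S
    exchange {I} {A} indep sep = begin
      ∫ μ (⟦_⟧ ∘ A) + U * i
        ≤⟨ +-monoˡ-≤ (U * i) (Measure.mono μ (λ v → ⟦⟧-split (A v) (I v))) ⟩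
      ∫ μ (λ v → ⟦ I v ∧ A v ⟧ + ⟦ B v ⟧) + U * i
        ≡⟨ cong (_+ U * i) (Measure.additive μ _ _) ⟩
      ∫ μ (λ v → ⟦ I v ∧ A v ⟧) + ∫ μ (⟦_⟧ ∘ B) + U * i
        ≤⟨ +-monoˡ-≤ (U * i) (+-monoʳ-≤ _ (∫-≤ B λ c → m+n≤o⇒m≤o∸n _ (class-bound c))) ⟩
      ∫ μ (λ v → ⟦ I v ∧ A v ⟧) + U * (S ∸ i) + U * i
        ≡⟨ +-assoc _ (U * (S ∸ i)) (U * i) ⟩
      ∫ μ (λ v → ⟦ I v ∧ A v ⟧) + (U * (S ∸ i) + U * i)
        ≡⟨ cong (∫ μ (λ v → ⟦ I v ∧ A v ⟧) +_) (sym (*-distribˡ-+ U (S ∸ i) i)) ⟩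
      ∫ μ (λ v → ⟦ I v ∧ A v ⟧) + U * (S ∸ i + i)
        ≡⟨ cong (λ x → ∫ μ (λ v → ⟦ I v ∧ A v ⟧) + U * x) (m∸n+n≡m (bounded I indep)) ⟩
      ∫ μ (λ v → ⟦ I v ∧ A v ⟧) + U * S ∎
      where
      open ≤-Reasoning
      i = ∫ μ (⟦_⟧ ∘ I)

      B : Vertex → Bool
      B v = A v ∧ not (I v)

      K : Fin n → Vertex → Bool
      K c v = (B v ∧ class c v) ∨ I v

      K-independent : ∀ c → Independent G (K c)
      K-independent c {u} {v} uv Ku Kv with T-∨⁻ {B u ∧ class c u} Ku | T-∨⁻ {B v ∧ class c v} Kv
      ... | inj₁ p | inj₁ q = class-independent c uv (proj₂ (T-∧⁻ {B u} p)) (proj₂ (T-∧⁻ {B v} q))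
      ... | inj₂ p | inj₁ q = sep uv p (proj₁ (T-∧⁻ {A v} (proj₁ (T-∧⁻ {B v} q))))
      ... | inj₁ p | inj₂ q = sep (symmetric uv) q (proj₁ (T-∧⁻ {A u} (proj₁ (T-∧⁻ {B u} p))))
      ... | inj₂ p | inj₂ q = indep uv p q

      class-bound : ∀ c → ∫ μ (λ v → ⟦ B v ∧ class c v ⟧) + i ≤ S
      class-bound c = begin
        ∫ μ (λ v → ⟦ B v ∧ class c v ⟧) + i           ≡⟨ Measure.additive μ _ _ ⟨
        ∫ μ (λ v → ⟦ B v ∧ class c v ⟧ + ⟦ I v ⟧)
          ≤⟨ Measure.mono μ (λ v → ⟦⟧-∨ (A v) (I v) (class c v)) ⟩
        ∫ μ (⟦_⟧ ∘ K c)                               ≤⟨ bounded (K c) (K-independent c) ⟩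
        S                                             ∎

-- Generalized Mycielskians

-- The sum 1 + U + ... + U^m.
geometric : ℕ → ℕ → ℕ
geometric U zero    = 1
geometric U (suc m) = U * geometric U m + 1

-- The sum over j ≤ m of U^j times the image of `μ` on level d + j, in Horner form.
levels : ∀ {A B : Set} → ℕ → Measure A → (ℕ → A → B) → ℕ → ℕ → Measure B
levels U μ φ d zero    = pushforward (φ d) μ
levels U μ φ d (suc m) = (U · levels U μ φ (suc d) m) ⊕ pushforward (φ d) μ

-- Levels 1 to m + 2 together with the apex `z`. The weight S of `z` is as large as the bound on
-- independent sets allows.
mycielski : ∀ {A B : Set} → ℕ → ℕ → ℕ → Measure A → (ℕ → A → B) → B → Measure B
mycielski U S m μ φ z = levels U μ φ 1 (suc m) ⊕ (S · dirac z)

∫-levels-1 : ∀ {A B : Set} U (μ : Measure A) (φ : ℕ → A → B) d m →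
             ∫ (levels U μ φ d m) (λ _ → 1) ≡ geometric U m * ∫ μ (λ _ → 1)
∫-levels-1 U μ φ d zero    = sym (*-identityˡ _)
∫-levels-1 U μ φ d (suc m) =
  trans (cong (λ x → U * x + ∫ μ (λ _ → 1)) (∫-levels-1 U μ φ (suc d) m))
        (rearrange U (geometric U m) (∫ μ (λ _ → 1)))
  where
  rearrange : ∀ u b t → u * (b * t) + t ≡ (u * b + 1) * t
  rearrange = solve-∀

module _ {G H : Graph} {k n U : ℕ} (C : Coloring G (suc k) n) (n≤ : n ≤ U * suc k)
         (μ : Measure (Graph.Vertex G)) {S : ℕ} (bounded : _BoundedBy_ {G} μ S)
         (φ : ℕ → Graph.Vertex G → Graph.Vertex H)
         (φ-adj : ∀ d {u v} → Graph.Adj G u v → Graph.Adj H (φ d u) (φ (suc d) v))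
         where
  open FractionalColoring {U = U} C n≤ μ
  private module H = Graph H

  module _ (I : H.Vertex → Bool) (indep : Independent H I) where

    -- The vertices of G whose images on all levels from d to d + m lie in `I`.
    core : ℕ → ℕ → Graph.Vertex G → Bool
    core d zero    v = I (φ d v)
    core d (suc m) v = core (suc d) m v ∧ I (φ d v)

    core⊆ : ∀ d m {v} → T (core d m v) → T (I (φ d v))
    core⊆ d zero    p = p
    core⊆ d (suc m) p = proj₂ (T-∧⁻ {core (suc d) m _} p)

    -- The core is contained in the part of `I` on the last level.
    core-independent : ∀ d m → Independent G (I ∘ φ (m + d)) → Independent G (core d m)
    core-independent d zero    base = base
    core-independent d (suc m) base uv p q =
      core-independent (suc d) m
        (subst (λ e → Independent G (I ∘ φ e)) (sym (+-suc m d)) base) uv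
        (proj₁ (T-∧⁻ p)) (proj₁ (T-∧⁻ q))

    -- In terms of deficits from S: the deficit of the core is at most the combined
    -- deficit of the levels, written without subtraction.
    levels≤ : ∀ d m → Independent G (I ∘ φ (m + d)) →
              ∫ (levels U μ φ d m) (⟦_⟧ ∘ I) + S ≤ geometric U m * S + ∫ μ (⟦_⟧ ∘ core d m)
    levels≤ d zero base =
      ≤-reflexive (trans (+-comm _ S) (cong (_+ ∫ μ (λ v → ⟦ I (φ d v) ⟧)) (sym (*-identityˡ S))))
    levels≤ d (suc m) base = +-cancelʳ-≤ (U * S + U * c) _ _ (begin
      U * L + a + S + (U * S + U * c)           ≡⟨ rearrange₁ U L a S c ⟩
      U * (L + S) + (a + U * c) + S
        ≤⟨ +-monoˡ-≤ S (+-mono-≤ (*-monoʳ-≤ U (levels≤ (suc d) m base′))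
             (exchange bounded (core-independent (suc d) m base′)
               -- The edges between levels d and d + 1 separate the core of the later levels from
               -- `I` on level d.
               λ uv p q → indep (H.symmetric (φ-adj d (Graph.symmetric G uv)))
                                (core⊆ (suc d) m p) q)) ⟩
      U * (g * S + c) + (c′ + U * S) + S        ≡⟨ rearrange₂ U g S c c′ ⟩
      (U * g + 1) * S + c′ + (U * S + U * c)    ∎)
      where
      open ≤-Reasoning
      base′ = subst (λ e → Independent G (I ∘ φ e)) (sym (+-suc m d)) base
      L = ∫ (levels U μ φ (suc d) m) (⟦_⟧ ∘ I)
      a = ∫ μ (λ v → ⟦ I (φ d v) ⟧)
      c = ∫ μ (⟦_⟧ ∘ core (suc d) m)
      c′ = ∫ μ (⟦_⟧ ∘ core d (suc m))
      g = geometric U m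

      rearrange₁ : ∀ u l a s c →
                   u * l + a + s + (u * s + u * c) ≡ u * (l + s) + (a + u * c) + s
      rearrange₁ = solve-∀

      rearrange₂ : ∀ u g s c c′ →
                   u * (g * s + c) + (c′ + u * s) + s ≡ (u * g + 1) * s + c′ + (u * s + u * c)
      rearrange₂ = solve-∀

    levels≤geometric : ∀ d m → Independent G (I ∘ φ (m + d)) →
                       ∫ (levels U μ φ d m) (⟦_⟧ ∘ I) ≤ geometric U m * S
    levels≤geometric d m base = +-cancelʳ-≤ S _ _ (≤-trans (levels≤ d m base)
      (+-monoʳ-≤ _ (bounded (core d m) (core-independent d m base))))

    level-independent : ∀ {d e} →
      (∀ {u v} → Graph.Adj G u v → H.Adj (φ d u) (φ d v)) →
      e ≡ d → Independent G (I ∘ φ e)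
    level-independent φ-hom refl uv = indep (φ-hom uv)

  -- If `I` avoids `z`, the levels alone obey the bound. If `I` contains `z`, it misses level 1,
  -- whose share S of the bound pays for `z`. In both cases `I` is independent on the last level
  -- because `φ (2 + m)` is a homomorphism.
  mycielski-bounded : ∀ m (z : H.Vertex) → (∀ v → H.Adj z (φ 1 v)) →
    (∀ {u v} → Graph.Adj G u v → H.Adj (φ (2 + m) u) (φ (2 + m) v)) →
    _BoundedBy_ {H} (mycielski U S m μ φ z) (geometric U (suc m) * S)
  mycielski-bounded m z z-adj φ-hom I indep with I z in eq
  ... | false = begin
    U * L₂ + a + S * 0   ≡⟨ cong (U * L₂ + a +_) (*-zeroʳ S) ⟩
    U * L₂ + a + 0       ≡⟨ +-identityʳ _ ⟩
    U * L₂ + a           ≤⟨ levels≤geometric I indep 1 (suc m)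
      (level-independent I indep φ-hom (+-comm (suc m) 1)) ⟩
    geometric U (suc m) * S ∎
    where
    open ≤-Reasoning
    L₂ = ∫ (levels U μ φ 2 m) (⟦_⟧ ∘ I)
    a = ∫ μ (λ v → ⟦ I (φ 1 v) ⟧)
  ... | true = begin
    U * L₂ + a + S * 1                     ≤⟨ +-monoˡ-≤ (S * 1) (+-mono-≤
      (*-monoʳ-≤ U (levels≤geometric I indep 2 m
        (level-independent I indep φ-hom (+-comm m 2))))
      a≤0) ⟩
    U * (geometric U m * S) + 0 + S * 1    ≡⟨ rearrange U (geometric U m) S ⟩
    geometric U (suc m) * S                ∎
    where
    open ≤-Reasoning
    L₂ = ∫ (levels U μ φ 2 m) (⟦_⟧ ∘ I)
    a = ∫ μ (λ v → ⟦ I (φ 1 v) ⟧)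

    vanish : ∀ v b → I (φ 1 v) ≡ b → ⟦ b ⟧ ≤ 0
    vanish v false _ = z≤n
    vanish v true  p = contradiction (subst T (sym p) tt) (indep (z-adj v) (subst T (sym eq) tt))

    a≤0 : a ≤ 0
    a≤0 = ≤-trans (Measure.mono μ (λ v → vanish v (I (φ 1 v)) refl))
                  (≤-reflexive (Measure.∫-0 μ))

    rearrange : ∀ u g s → u * (g * s) + 0 + s * 1 ≡ (u * g + 1) * s
    rearrange = solve-∀

-- The homomorphism to W(s,t+1)

parity-suc : ∀ {p} n → parity n ≡ p → parity (suc n) ≢ p
parity-suc n eq eq′ with parity n | parity (suc n) | suc-homo-⁻¹ n
parity-suc n refl refl | 0ℙ | _ | ()
parity-suc n refl refl | 1ℙ | _ | ()

parity-case : ∀ n → parity n ≡ 0ℙ ⊎ parity n ≡ 1ℙ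
parity-case n with parity n
... | 0ℙ = inj₁ refl
... | 1ℙ = inj₂ refl

parity-double : ∀ n → parity (n + n) ≡ 0ℙ
parity-double n = trans (+-homo-+ n n) (p+p≡0ℙ (parity n))

-- Adjacency in one coordinate before truncation at s.
data Near (s : ℕ) : ℕ → ℕ → Set where
  up   : ∀ {n} → Near s n (suc n)
  down : ∀ {n} → Near s (suc n) n
  far  : ∀ {m n} → s ≤ m → s ≤ n → Near s m n

near-sym : ∀ {s m n} → Near s m n → Near s n m
near-sym up        = down
near-sym down      = up
near-sym (far p q) = far q p

near-≡ : ∀ {s m m′ n n′} → m ≡ m′ → n ≡ n′ → Near s m n → Near s m′ n′
near-≡ refl refl near = near

∣-∣≡1⇒near : ∀ {s} m n → ∣ m - n ∣ ≡ 1 → Near s m n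
∣-∣≡1⇒near zero          (suc zero)    _  = up
∣-∣≡1⇒near (suc zero)    zero          _  = down
-- The threshold of the recursive call exceeds m and n, which rules out `far`; a difference of 1
-- survives the shift.
∣-∣≡1⇒near (suc m)       (suc n)       eq = shift (∣-∣≡1⇒near {suc (m ⊔ n)} m n eq)
  where
  shift : ∀ {s m n} → Near (suc (m ⊔ n)) m n → Near s (suc m) (suc n)
  shift up   = up
  shift down = down
  shift {m = m} {n} (far p _) = contradiction (m≤m⊔n m n) (<⇒≱ p)

near-cap : ∀ {s m n} → Near s m n → ∣ s ⊓ m - s ⊓ n ∣ ≡ 1 ⊎ (s ⊓ m ≡ s × s ⊓ n ≡ s)
near-cap (far p q) = inj₂ (m≤n⇒m⊓n≡m p , m≤n⇒m⊓n≡m q)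
near-cap {s} (up {n}) with ≤-<-connex s n
... | inj₁ s≤n = inj₂ (m≤n⇒m⊓n≡m s≤n , m≤n⇒m⊓n≡m (m≤n⇒m≤1+n s≤n))
... | inj₂ n<s rewrite m≥n⇒m⊓n≡n n<s | m≥n⇒m⊓n≡n (<⇒≤ n<s) = inj₁ (diff n)
  where
  diff : ∀ n → ∣ n - suc n ∣ ≡ 1
  diff zero    = refl
  diff (suc n) = diff n
near-cap {s} (down {n}) with near-cap {s} (up {n = n})
... | inj₁ eq      = inj₁ (trans (∣-∣-comm (s ⊓ suc n) (s ⊓ n)) eq)
... | inj₂ (p , q) = inj₂ (q , p)

-- The path of a single coordinate through the levels

module Strands (s : ℕ) where

  -- The strand `high` rises to s in the first s steps and falls back to a ≤ s in the next s.
  -- Evenness of `r` lets `new` pass from 1 to 2 at distance `r`.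
  r : ℕ
  r = s + s

  -- The value at distance d from the apex of a coordinate equal to a is low or high
  -- according to the parity of d + a.  An edge from distance d to distance d + 1
  -- preserves this parity, except at a = s, where both strands agree up to truncation.
  low : ℕ → ℕ → ℕ
  low d a = a ⊓ suc d

  high : ℕ → ℕ → ℕ
  high d a with d <? s
  ... | yes _ = suc d
  ... | no  _ = a ⊔ (r ∸ d)

  strand : Parity → ℕ → ℕ → ℕ
  strand 0ℙ = high
  strand 1ℙ = low

  old : ℕ → ℕ → ℕ
  old d a = strand (parity (d + a)) d a

  -- Below `r` it supplies the zero at even distances and a 1 at odd ones, while the old coordinates
  -- supply the other value. Later it grows until truncation fixes it at s.
  new : ℕ → ℕ
  new d with d <? r | parity d
  ... | yes _ | 0ℙ = 0
  ... | yes _ | 1ℙ = 1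
  ... | no  _ | _  = 2 + (d ∸ r)

  s≤r : s ≤ r
  s≤r = m≤m+n s s

  s≤r∸ : ∀ {d} → d ≤ s → s ≤ r ∸ d
  s≤r∸ d≤s = ≤-trans (≤-reflexive (sym (m+n∸n≡m s s))) (∸-monoʳ-≤ r d≤s)

  low-down : ∀ d a → parity (suc (d + a)) ≡ 1ℙ → Near s (low d (suc a)) (low (suc d) a)
  low-down d a odd with <-cmp a (suc d)
  ... | tri< (s≤s a≤d) _ _
    rewrite m≤n⇒m⊓n≡m a≤d | m≤n⇒m⊓n≡m (m≤n⇒m≤1+n (m≤n⇒m≤1+n a≤d)) = down
  -- Both values would be d + 1 here; the parity excludes this.
  ... | tri≈ _ refl _ rewrite +-suc d d =
    contradiction (trans (sym (parity-double d)) odd) λ ()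
  ... | tri> _ _ d+1<a
    rewrite m≥n⇒m⊓n≡n (≤-trans (n≤1+n d) (<⇒≤ d+1<a)) | m≥n⇒m⊓n≡n d+1<a = up

  -- In the excluded case both maxima equal `suc a`.
  ⊔-near-up : ∀ a k → suc a ≢ k → Near s (a ⊔ k) (suc a ⊔ pred k)
  ⊔-near-up a zero    _ rewrite ⊔-identityʳ a = up
  ⊔-near-up a (suc k) a≢k with <-cmp a k
  ... | tri< a<k _ _ rewrite m≤n⇒m⊔n≡n (m≤n⇒m≤1+n (<⇒≤ a<k)) | m≤n⇒m⊔n≡n a<k = down
  ... | tri≈ _ refl _ = contradiction refl a≢k
  ... | tri> _ _ k<a rewrite m≥n⇒m⊔n≡m k<a | m≥n⇒m⊔n≡m (m≤n⇒m≤1+n (<⇒≤ k<a)) = up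

  ⊔-near-down : ∀ a k → Near s (suc a ⊔ k) (a ⊔ pred k)
  ⊔-near-down a zero    rewrite ⊔-identityʳ a = down
  ⊔-near-down a (suc k) = down

  high-near : ∀ d a b → Near s (a ⊔ (r ∸ d)) (b ⊔ pred (r ∸ d)) →
              Near s (high d a) (high (suc d) b)
  high-near d a b near with d <? s | suc d <? s
  ... | yes _   | yes _     = up
  -- The change of formula at distance s is hidden by truncation, as both values are at least s.
  ... | yes d<s | no  1+d≮s = far (≮⇒≥ 1+d≮s) (≤-trans (s≤r∸ d<s) (m≤n⊔m b _))
  ... | no  d≮s | yes 1+d<s = contradiction (≤-trans (n≤1+n _) 1+d<s) d≮s
  ... | no  _   | no  _     =
    near-≡ refl (cong (b ⊔_) (pred[m∸n]≡m∸[1+n] r d)) near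

  high-up : ∀ d a → parity (d + a) ≡ 0ℙ → Near s (high d a) (high (suc d) (suc a))
  high-up d a even = high-near d a (suc a) (⊔-near-up a (r ∸ d) λ eq →
    -- If `suc a` were `r ∸ d`, then d + a + 1 would be the even number `r`.
    parity-suc (d + a) even (trans (cong parity (trans (sym (+-suc d a))
      (trans (cong (d +_) eq) (m+[n∸m]≡n (<⇒≤ (m∸n≢0⇒n<m {r} {d} λ z → 1+n≢0 (trans eq z)))))))
      (parity-double s)))

  high-down : ∀ d a → Near s (high d (suc a)) (high (suc d) a)
  high-down d a = high-near d (suc a) a (⊔-near-down a (r ∸ d))

  old-up : ∀ d a → Near s (old d a) (old (suc d) (suc a))
  old-up d a rewrite +-suc d a with parity (d + a) in eq
  ... | 0ℙ = high-up d a eq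
  ... | 1ℙ = up

  old-down : ∀ d a → Near s (old d (suc a)) (old (suc d) a)
  old-down d a rewrite +-suc d a with parity (suc (d + a)) in eq
  ... | 0ℙ = high-down d a
  ... | 1ℙ = low-down d a eq

  old-s-< : ∀ {d} → d < s → old d s ≡ suc d
  old-s-< {d} d<s with parity (d + s)
  ... | 1ℙ = m≥n⇒m⊓n≡n d<s
  ... | 0ℙ with d <? s
  ...   | yes _   = refl
  ...   | no  d≮s = contradiction d<s d≮s

  old-s-≥ : ∀ {d} → s ≤ d → s ≤ old d s
  old-s-≥ {d} s≤d with parity (d + s)
  ... | 1ℙ = ⊓-glb ≤-refl (m≤n⇒m≤1+n s≤d)
  ... | 0ℙ with d <? s
  ...   | yes d<s = contradiction s≤d (<⇒≱ d<s)
  ...   | no  _   = m≤m⊔n s _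

  -- The parity of d + s flips along such an edge. Below distance s both strands give d + 1, and
  -- from s on both are at least s.
  old-s : ∀ d → Near s (old d s) (old (suc d) s)
  old-s d with ≤-<-connex s d | ≤-<-connex s (suc d)
  ... | inj₁ s≤d | _          = far (old-s-≥ s≤d) (old-s-≥ (m≤n⇒m≤1+n s≤d))
  ... | inj₂ d<s | inj₂ 1+d<s = near-≡ (sym (old-s-< d<s)) (sym (old-s-< 1+d<s)) up
  ... | inj₂ d<s | inj₁ s≤1+d =
    far (≤-trans s≤1+d (≤-reflexive (sym (old-s-< d<s)))) (old-s-≥ s≤1+d)

  old-near : ∀ d {a b} → a ≤ s → b ≤ s → Near s a b → Near s (old d a) (old (suc d) b)
  old-near d _   _   (up {n})   = old-up d n
  old-near d _   _   (down {n}) = old-down d n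
  old-near d a≤s b≤s (far s≤a s≤b) with refl ← ≤-antisym a≤s s≤a | refl ← ≤-antisym b≤s s≤b =
    old-s d

  new-near : ∀ d → Near s (new d) (new (suc d))
  new-near d with d <? r | suc d <? r | parity d in eq | parity (suc d) in eq′
  ... | yes _   | yes _    | 0ℙ | 0ℙ = contradiction eq′ (parity-suc d eq)
  ... | yes _   | yes _    | 0ℙ | 1ℙ = up
  ... | yes _   | yes _    | 1ℙ | 0ℙ = down
  ... | yes _   | yes _    | 1ℙ | 1ℙ = contradiction eq′ (parity-suc d eq)
  ... | no  d≮r | yes d+1<r | _ | _  = contradiction (≤-trans (n≤1+n _) d+1<r) d≮r
  -- Here d + 1 = `r` is even, so d is odd.
  ... | yes d<r | no d+1≮r | 0ℙ | _  = contradiction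
    (trans (cong parity (≤-antisym d<r (≮⇒≥ d+1≮r))) (parity-double s)) (parity-suc d eq)
  ... | yes d<r | no _      | 1ℙ | _  rewrite m≤n⇒m∸n≡0 d<r = up
  ... | no  d≮r | no _      | _  | _  rewrite +-∸-assoc 1 (≮⇒≥ d≮r) = up

  new-even : ∀ {d} → d < r → parity d ≡ 0ℙ → new d ≡ 0
  new-even {d} d<r even with d <? r | parity d
  ... | yes _   | 0ℙ = refl
  ... | no  d≮r | _  = contradiction d<r d≮r

  new-odd : ∀ {d} → d < r → parity d ≡ 1ℙ → new d ≡ 1
  new-odd {d} d<r odd with d <? r | parity d
  ... | yes _   | 1ℙ = refl
  ... | no  d≮r | _  = contradiction d<r d≮r

  new-late : ∀ {d} → r ≤ d → new d ≡ 2 + (d ∸ r)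
  new-late {d} r≤d with d <? r
  ... | yes d<r = contradiction r≤d (<⇒≱ d<r)
  ... | no  _   = refl

  old-late : ∀ {d a} → a ≤ s → r ≤ d → old d a ≡ a
  old-late {d} {a} a≤s r≤d with parity (d + a)
  ... | 1ℙ = m≤n⇒m⊓n≡m (≤-trans a≤s (≤-trans s≤r (m≤n⇒m≤1+n r≤d)))
  ... | 0ℙ with d <? s
  ...   | yes d<s = contradiction (≤-trans s≤r r≤d) (<⇒≱ d<s)
  ...   | no  _   rewrite m≤n⇒m∸n≡0 r≤d = ⊔-identityʳ a

  high≢0 : ∀ {d} a → d < r → high d a ≢ 0
  high≢0 {d} a d<r eq with d <? s
  high≢0 {d} a d<r () | yes _
  ... | no _ = contradiction (≤-trans (m≤n⊔m a (r ∸ d)) (≤-reflexive eq)) (<⇒≱ (m<n⇒0<n∸m d<r))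

  old≡0⇒≡0 : ∀ {d a} → d < r → old d a ≡ 0 → a ≡ 0
  old≡0⇒≡0 {d} {a} d<r eq with parity (d + a)
  ... | 0ℙ = contradiction eq (high≢0 a d<r)
  old≡0⇒≡0 {d} {zero} d<r eq | 1ℙ = refl

  old-0-odd : ∀ {d} → parity d ≡ 1ℙ → old d 0 ≡ 0
  old-0-odd {d} odd rewrite +-identityʳ d | odd = refl

  old-even≢0 : ∀ {d} a → d < r → parity d ≡ 0ℙ → old d a ≢ 0
  old-even≢0 {d} a d<r even eq with refl ← old≡0⇒≡0 {d} {a} d<r eq
    rewrite +-identityʳ d | even = high≢0 0 d<r eq

  old-1-even : ∀ {d} → parity d ≡ 0ℙ → old d 1 ≡ 1
  old-1-even {d} even rewrite +-comm d 1 with parity (suc d) in eq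
  ... | 0ℙ = contradiction eq (parity-suc d even)
  ... | 1ℙ = refl

  old-0 : 0 < s → ∀ a → old 0 a ≡ 1
  old-0 0<s a with parity a in eq
  ... | 0ℙ with 0 <? s
  ...   | yes _   = refl
  ...   | no  0≮s = contradiction 0<s 0≮s
  old-0 0<s (suc a) | 1ℙ = cong suc (⊓-zeroʳ a)

  -- As `old 0` is constant, a may be replaced by a number next to b.
  old-0-near : 0 < s → ∀ a b → Near s (old 0 a) (old 1 b)
  old-0-near 0<s a zero    = near-≡ (trans (old-0 0<s 1) (sym (old-0 0<s a))) refl (old-down 0 0)
  old-0-near 0<s a (suc b) = near-≡ (trans (old-0 0<s b) (sym (old-0 0<s a))) refl (old-up 0 b)

-- Levels and apex as vertices of W(s,t+1)

module Levels (s : ℕ) (0<s : 0 < s) where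
  open Strands s

  0<r : 0 < r
  0<r = ≤-trans 0<s s≤r

  cap : ℕ → Fin (suc s)
  cap n = fromℕ< (s≤s (m⊓n≤m s n))

  toℕ-cap : ∀ n → toℕ (cap n) ≡ s ⊓ n
  toℕ-cap n = toℕ-fromℕ< (s≤s (m⊓n≤m s n))

  cap-≡ : ∀ {m n} → m ≡ n → n ≤ s → toℕ (cap m) ≡ n
  cap-≡ refl n≤s = trans (toℕ-cap _) (m≥n⇒m⊓n≡n n≤s)

  cap≢0 : ∀ {n} → n ≢ 0 → toℕ (cap n) ≢ 0
  cap≢0 {n} n≢0 eq =
    <⇒≢ (⊓-glb 0<s (n≢0⇒n>0 n≢0)) (sym (trans (sym (toℕ-cap n)) eq))

  cap-near : ∀ {m n} → Near s m n →
             ∣ toℕ (cap m) - toℕ (cap n) ∣ ≡ 1 ⊎ (toℕ (cap m) ≡ s × toℕ (cap n) ≡ s)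
  cap-near {m} {n} near rewrite toℕ-cap m | toℕ-cap n = near-cap near

  level : ∀ {t} → ℕ → Sequence s t → Sequence s (suc t)
  level d x = cap (new d) ∷ map (cap ∘ old d ∘ toℕ) x

  adjacent⇒near : ∀ {t} (x y : Sequence s t) → AdjSeq x y →
                  ∀ i → Near s (toℕ (lookup x i)) (toℕ (lookup y i))
  adjacent⇒near x y xy i with xy i
  ... | inj₁ diff        = ∣-∣≡1⇒near (toℕ (lookup x i)) (toℕ (lookup y i)) diff
  ... | inj₂ (x≡s , y≡s) = far (≤-reflexive (sym x≡s)) (≤-reflexive (sym y≡s))

  near⇒adjacent : ∀ {t} d e (x y : Sequence s t) → Near s (new d) (new e) →
                  (∀ i → Near s (old d (toℕ (lookup x i))) (old e (toℕ (lookup y i)))) →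
                  AdjSeq (level d x) (level e y)
  near⇒adjacent d e x y near _ zero = cap-near near
  near⇒adjacent d e x y _ nears (suc i)
    rewrite lookup-map i (cap ∘ old d ∘ toℕ) x | lookup-map i (cap ∘ old e ∘ toℕ) y =
    cap-near (nears i)

  level-adjacent : ∀ {t} d {x y : Sequence s t} → AdjSeq x y → AdjSeq (level d x) (level (suc d) y)
  level-adjacent d {x} {y} xy = near⇒adjacent d (suc d) x y (new-near d) λ i →
    old-near d (toℕ≤pred[n] (lookup x i)) (toℕ≤pred[n] (lookup y i)) (adjacent⇒near x y xy i)

  -- The old coordinates are again those of x and y, and the new one is truncated to s, a value
  -- adjacent to itself.
  level-hom : ∀ {t} d → s + r ≤ d → {x y : Sequence s t} → AdjSeq x y →
              AdjSeq (level d x) (level d y)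
  level-hom d s+r≤d {x} {y} xy = near⇒adjacent d d x y (far s≤new s≤new) λ i →
    near-≡ (sym (old-late (toℕ≤pred[n] (lookup x i)) r≤d)) (sym (old-late (toℕ≤pred[n] (lookup y i)) r≤d))
           (adjacent⇒near x y xy i)
    where
    r≤d : r ≤ d
    r≤d = ≤-trans (m≤n+m r s) s+r≤d
    s≤new : s ≤ new d
    s≤new = ≤-trans (m+n≤o⇒m≤o∸n s s+r≤d)
              (≤-trans (m≤n+m (d ∸ r) 2) (≤-reflexive (sym (new-late r≤d))))

  lookup-old : ∀ {t} d (x : Sequence s t) i →
               lookup (map (cap ∘ old d ∘ toℕ) x) i ≡ cap (old d (toℕ (lookup x i)))
  lookup-old d x i = lookup-map i (cap ∘ old d ∘ toℕ) x

  -- From `r` on, x itself provides the zero and a 1. Below `r`, at even d the new coordinate is the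
  -- only zero and an old 1 stays 1; at odd d the zero of x stays the only one and the new
  -- coordinate is 1.
  level-vertex : ∀ {t} d {x : Sequence s t} → IsVertex x → IsVertex (level d x)
  level-vertex d {x} ((i , xi≡0 , unique) , (j , xj≡1)) with ≤-<-connex r d
  ... | inj₁ r≤d =
    (suc i , trans (fixed i) xi≡0 , only) , (suc j , trans (fixed j) xj≡1)
    where
    fixed : ∀ k → toℕ (lookup (level d x) (suc k)) ≡ toℕ (lookup x k)
    fixed k = trans (cong toℕ (lookup-old d x k))
      (cap-≡ (old-late (toℕ≤pred[n] _) r≤d) (toℕ≤pred[n] _))
    only : ∀ {k} → toℕ (lookup (level d x) k) ≡ 0 → suc i ≡ k
    only {zero}  eq = contradiction eq (cap≢0 (λ p → 1+n≢0 (trans (sym (new-late r≤d)) p)))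
    only {suc k} eq = cong suc (unique (trans (sym (fixed k)) eq))
  ... | inj₂ d<r with parity-case d
  ...   | inj₁ par = (zero , cap-≡ (new-even d<r par) z≤n , only) ,
               (suc j , trans (cong toℕ (lookup-old d x j))
                  (cap-≡ (trans (cong (old d) xj≡1) (old-1-even {d} par)) 0<s))
    where
    only : ∀ {k} → toℕ (lookup (level d x) k) ≡ 0 → zero ≡ k
    only {zero}  _  = refl
    only {suc k} eq = contradiction (trans (sym (cong toℕ (lookup-old d x k))) eq)
                        (cap≢0 (old-even≢0 {d} _ d<r par))
  ...   | inj₂ par = (suc i , trans (cong toℕ (lookup-old d x i))
                  (cap-≡ (trans (cong (old d) xi≡0) (old-0-odd {d} par)) z≤n) , only) ,
               (zero , cap-≡ (new-odd d<r par) 0<s)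
    where
    only : ∀ {k} → toℕ (lookup (level d x) k) ≡ 0 → suc i ≡ k
    only {zero}  eq = contradiction (trans (sym (cap-≡ (new-odd d<r par) 0<s)) eq) 1+n≢0
    only {suc k} eq with toℕ (lookup x k) ≟ 0
    ... | yes xk≡0 = cong suc (unique xk≡0)
    ... | no  xk≢0 = contradiction (trans (sym (cong toℕ (lookup-old d x k))) eq)
                       (cap≢0 (xk≢0 ∘ old≡0⇒≡0 {d} d<r))

  -- The sequence (0,1,...,1). Level 0 does not depend on its argument, so the choice of zeros is
  -- arbitrary.
  apex : ∀ t → Sequence s (suc t)
  apex t = level 0 (replicate t zero)

  apex-adjacent : ∀ {t} (x : Sequence s t) → AdjSeq (apex t) (level 1 x)
  apex-adjacent {t} x = near⇒adjacent 0 1 (replicate t zero) x (new-near 0) λ i →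
    old-0-near 0<s (toℕ (lookup (replicate t zero) i)) (toℕ (lookup x i))

  apex-vertex : ∀ t → IsVertex (apex (suc t))
  apex-vertex t = (zero , cap-≡ (new-even 0<r refl) z≤n , only) , (suc zero , cap-≡ (old-0 0<s 0) 0<s)
    where
    only : ∀ {k} → toℕ (lookup (apex (suc t)) k) ≡ 0 → zero ≡ k
    only {zero}  _  = refl
    only {suc k} eq = contradiction (trans (sym (cong toℕ (lookup-old 0 (replicate (suc t) zero) k))) eq)
                        (cap≢0 (λ p → 1+n≢0 (trans (sym (old-0 0<s (toℕ (lookup (replicate (suc t) zero) k)))) p)))

  private module W (t : ℕ) = Graph (W s t)

  levelᵂ : ∀ {t} → ℕ → W.Vertex t → W.Vertex (suc t)
  levelᵂ d (x ,ʳ [ p ]) = level d x ,ʳ [ level-vertex d p ]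

  apexᵂ : ∀ t → W.Vertex (2 + t)
  apexᵂ t = apex (suc t) ,ʳ [ apex-vertex t ]

  -- The last level, at distance at least s + r from the apex, is a copy of W(s,t).
  restrict : ∀ {t k n} → Coloring (W s (suc t)) k n → Coloring (W s t) k n
  restrict C = record
    { color    = C.color ∘ levelᵂ (s + r)
    ; size     = C.size ∘ levelᵂ (s + r)
    ; disjoint = λ { (_ ,ʳ [ _ ]) (_ ,ʳ [ _ ]) uv → C.disjoint _ _ (level-hom (s + r) ≤-refl uv) }
    }
    where module C = Coloring C

  -- Iterated weightings and the lower bound

  module _ (U : ℕ) where

    -- The factor by which one step from t to t + 1 multiplies the bound on independent sets.
    B : ℕ
    B = geometric U (suc (s + r))

    weight : ∀ t → Measure (W.Vertex (suc t))
    -- W(s,1) has no vertices, since its only coordinate cannot be both 0 and 1.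
    weight zero    = null
    weight (suc t) = mycielski U (B ^ t) (s + r) (weight t) levelᵂ (apexᵂ t)

    -- The coloring restricts to all earlier graphs, so a single U serves throughout the induction.
    weight-bounded : ∀ t {k n} → Coloring (W s (suc t)) (suc k) n → n ≤ U * suc k →
                     _BoundedBy_ {W s (suc t)} (weight t) (B ^ t)
    weight-bounded zero    _ _  _ _ = z≤n
    weight-bounded (suc t) C n≤ = mycielski-bounded {W s (suc t)} {W s (2 + t)} {U = U} (restrict C) n≤
      (weight t) (weight-bounded t (restrict C) n≤) levelᵂ
      (λ { d {_ ,ʳ [ _ ]} {_ ,ʳ [ _ ]} uv → level-adjacent d uv }) (s + r) (apexᵂ t)
      (λ { (x ,ʳ [ _ ]) → apex-adjacent x })
      (λ { {_ ,ʳ [ _ ]} {_ ,ʳ [ _ ]} uv → level-hom (2 + (s + r)) (m≤n+m (s + r) 2) uv })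

    total : ℕ → ℕ
    total t = ∫ (weight t) (λ _ → 1)

    -- Relative to the bound `B ^ t`, the total gains 1/B per step: `total (suc t)` equals
    -- `B * total t + B ^ t`.
    total≥ : ∀ t → t * B ^ t ≤ total t * B
    total≥ zero    = z≤n
    total≥ (suc t) = begin
      suc t * (B * B ^ t)                  ≡⟨ rearrange₁ t B (B ^ t) ⟩
      (t * B ^ t + B ^ t) * B              ≤⟨ *-monoˡ-≤ B (+-monoˡ-≤ (B ^ t) (total≥ t)) ⟩
      (total t * B + B ^ t) * B            ≡⟨ cong (_* B) (rearrange₂ (total t) B (B ^ t)) ⟩
      (B * total t + B ^ t * 1) * B        ≡⟨ cong (λ x → (x + B ^ t * 1) * B)
        (∫-levels-1 U (weight t) levelᵂ 1 (suc (s + r))) ⟨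
      total (suc t) * B                    ∎
      where
      open ≤-Reasoning
      rearrange₁ : ∀ t b p → suc t * (b * p) ≡ (t * p + p) * b
      rearrange₁ = solve-∀
      rearrange₂ : ∀ a b p → a * b + p ≡ b * a + p * 1
      rearrange₂ = solve-∀

    -- Otherwise the total weight, at least t/B times `B ^ t`, would be at most U times `B ^ t`.
    uncolorable : ∀ t {k n} → U * B < t → Coloring (W s (suc t)) (suc k) n → U * suc k < n
    uncolorable t {k} {n} UB<t C = ≰⇒> λ n≤ → <⇒≱ UB<t (*-cancelʳ-≤ t (U * B) (B ^ t) (begin
      t * B ^ t            ≤⟨ total≥ t ⟩
      total t * B          ≤⟨ *-monoˡ-≤ B (FractionalColoring.total≤ {U = U} C n≤ (weight t)
                                             (weight-bounded t C n≤)) ⟩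
      U * B ^ t * B        ≡⟨ rearrange U (B ^ t) B ⟩
      U * B * B ^ t        ∎))
      where
      open ≤-Reasoning
      instance
        B≢0 : NonZero B
        B≢0 = subst NonZero (+-comm 1 (U * geometric U (s + r))) _
        B^t≢0 : NonZero (B ^ t)
        B^t≢0 = m^n≢0 B t
      rearrange : ∀ a b c → a * b * c ≡ a * c * b
      rearrange = solve-∀

-- Passage to rational numbers

-- The denominator of M is at least 1, so M is at most the absolute value of its numerator.
≤-fraction : ∀ M {n k} → ℤ.∣ ℚ.numerator M ∣ * suc k ≤ n → M ≤ℚ (ℤ.+ n / suc k)
≤-fraction M@(mkℚ num d _) {n} {k} bound = toℚᵘ-cancel-≤ (ℚᵘ.≤-respʳ-≃
  (ℚᵘ.≃-sym (toℚᵘ-fromℚᵘ (mkℚᵘ (ℤ.+ n) k))) (*≤* (begin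
    num ℤ.* ℤ.+ suc k               ≤⟨ ℤ.*-monoʳ-≤-nonNeg (ℤ.+ suc k) (≤∣∣ num) ⟩
    ℤ.+ ℤ.∣ num ∣ ℤ.* ℤ.+ suc k     ≡⟨ ℤ.pos-* ℤ.∣ num ∣ (suc k) ⟨
    ℤ.+ (ℤ.∣ num ∣ * suc k)         ≤⟨ +≤+ (≤-trans bound (m≤m*n n (suc d))) ⟩
    ℤ.+ (n * suc d)                 ≡⟨ ℤ.pos-* n (suc d) ⟩
    ℤ.+ n ℤ.* ℤ.+ suc d             ∎)))
  where
  open ℤ.≤-Reasoning
  ≤∣∣ : ∀ i → i ℤ.≤ ℤ.+ ℤ.∣ i ∣
  ≤∣∣ (ℤ.+ i)  = ℤ.≤-refl
  ≤∣∣ -[1+ i ] = ℤ.-≤+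

theorem7 : (s : ℕ) → .{{_ : NonZero s}} → DivergesTo+∞ (λ t → χf (W s t))
-- One unit of the 2 is due to `weight t` living on W(s,t+1), the other to the strict inequality.
-- The minimality proof for `χ` contains the coloring that is used.
theorem7 s M = 2 + U * L.B U , λ { (suc t) (s≤s UB<t) k →
    ≤-fraction M (<⇒≤ (L.uncolorable U t UB<t (proj₁ (proj₂ (χ-minimum (W s (suc t)) (suc k)))))) }
  where
  module L = Levels s (>-nonZero⁻¹ s)
  U = ℤ.∣ ℚ.numerator M ∣
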